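{- Let $s\geq 2$, $n=2^{s-1}$, let $H\leq\mathbb{F}_2^s$ be a hyperplane, and let $M=[v_0,\ldots,v_{n-1}]$ be a list of $n$ nonzero vectors of $\mathbb{F}_2^s$ with $\sum_i v_i=0$. Suppose that exactly four of the indices $i$ satisfy $v_i\in H$ (i.e. $M$ is a zero-sum four-hole instance with respect to $H$), and that every vector occurring in $M$ occurs with even multiplicity. Then $M$ has a Hadamard pair solution, and one can be constructed explicitly.
   Context: A Hadamard pair solution for a list $M=[v_0,\ldots,v_{n-1}]$ of $n=2^{s-1}$ nonzero vectors of $\mathbb{F}_2^s$ is a partition $\mathbb{F}_2^s=\bigsqcup_{i=0}^{n-1}\{x_i,y_i\}$ of the whole space into $n$ pairs such that $x_i+y_i=v_i$ for every $i$. A request $v_i\in H$ is called a hole (internal request) with respect to $H$; a four-hole instance has exactly four holes counted with multiplicity, all remaining requests lying outside $H$. -}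

module Defs where

open import Data.Fin using (Fin)
open import Data.Nat using (ℕ; _∸_)
open import Data.Nat.Divisibility using (_∣_)
open import Data.Parity using (Parity; 0ℙ)
open import Data.Product using (Σ; ∃; ∃!; _×_)
open import Data.Sum using (_⊎_)
open import Data.Vec using (Vec; replicate; zipWith; map; foldr′; lookup; count)
open import Data.Vec.Membership.Propositional using (_∈_)
open import Data.Vec.Properties using (≡-dec)
open import Level using (Level; _⊔_)
open import Relation.Binary.Definitions using (DecidableEquality)
open import Relation.Binary.PropositionalEquality using (_≡_; _≢_)
open import Relation.Unary using (Pred; Decidable)
import Data.Parity as ℙ
import Data.Parity.Properties as ℙ

-- Parity, with its library ring structure, is the field with two elements.

𝔽₂ : Set
𝔽₂ = Parity

𝔽₂^ : ℕ → Set
𝔽₂^ s = Vec 𝔽₂ s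

infixl 6 _⊕_
infixl 7 _⊙_

𝟎 : ∀ {s} → 𝔽₂^ s
𝟎 {s} = replicate s 0ℙ

_⊕_ : ∀ {s} → 𝔽₂^ s → 𝔽₂^ s → 𝔽₂^ s
_⊕_ = zipWith ℙ._+_

_⊙_ : ∀ {s} → 𝔽₂ → 𝔽₂^ s → 𝔽₂^ s
c ⊙ x = map (c ℙ.*_) x

_≟_ : ∀ {s} → DecidableEquality (𝔽₂^ s)
_≟_ = ≡-dec ℙ._≟_

⨁ : ∀ {s n} → Vec (𝔽₂^ s) n → 𝔽₂^ s
⨁ = foldr′ _⊕_ 𝟎

linComb : ∀ {s d} → 𝔽₂^ d → Vec (𝔽₂^ s) d → 𝔽₂^ s
linComb c b = ⨁ (zipWith _⊙_ c b)

record IsSubspace {ℓ : Level} {s : ℕ} (H : Pred (𝔽₂^ s) ℓ) : Set ℓ where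
  field
    0-mem    : H 𝟎
    ⊕-closed : ∀ {x y} → H x → H y → H (x ⊕ y)
    ⊙-closed : ∀ c {x} → H x → H (c ⊙ x)

record IsBasisOf {ℓ : Level} {s d : ℕ} (b : Vec (𝔽₂^ s) d) (H : Pred (𝔽₂^ s) ℓ) : Set ℓ where
  field
    members     : ∀ i → H (lookup b i)
    independent : ∀ c → linComb c b ≡ 𝟎 → c ≡ 𝟎
    spanning    : ∀ x → H x → ∃ λ c → linComb c b ≡ x

HasDimension : ∀ {ℓ s} → Pred (𝔽₂^ s) ℓ → ℕ → Set ℓ
HasDimension {s = s} H d = Σ (Vec (𝔽₂^ s) d) λ b → IsBasisOf b H

-- For s = 0 the truncated subtraction would make this wrong; it is meant for s ≥ 1.

IsHyperplane : ∀ {ℓ s} → Pred (𝔽₂^ s) ℓ → Set ℓ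
IsHyperplane {s = s} H = IsSubspace H × HasDimension H (s ∸ 1)

-- Holes are counted with multiplicity. Membership in a subspace with a given
-- finite basis is always decidable, and the count does not depend on the decider.

holes : ∀ {ℓ s n} {H : Pred (𝔽₂^ s) ℓ} → Decidable H → Vec (𝔽₂^ s) n → ℕ
holes H? M = count H? M

multiplicity : ∀ {s n} → 𝔽₂^ s → Vec (𝔽₂^ s) n → ℕ
multiplicity v M = count (v ≟_) M

EvenMultiplicities : ∀ {s n} → Vec (𝔽₂^ s) n → Set
EvenMultiplicities M = ∀ v → v ∈ M → 2 ∣ multiplicity v M

-- A partition of the whole space into the two-element blocks {xᵢ, yᵢ}:
-- every z lies in the block of exactly one index i.

record HadamardPairSolution {s n : ℕ} (M : Vec (𝔽₂^ s) n) : Set where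
  field
    x y       : Fin n → 𝔽₂^ s
    distinct  : ∀ i → x i ≢ y i
    partition : ∀ z → ∃! _≡_ λ i → z ≡ x i ⊎ z ≡ y i
    pair-sum  : ∀ i → x i ⊕ y i ≡ lookup M i

{-# OPTIONS --safe #-}
module Submission where

-- Split M into two copies of a ∷ b ∷ D, with a and b in H and D outside H. In the quotient by a, a
-- partial matching between H and its complement can absorb the requests of D one at a time, by
-- shifting along an alternating path as in Hall's theorem on prescribed differences in abelian groups:
-- this works as long as two points on the same side of H are free. Lifting the matching serves every
-- request of D twice and leaves four cosets of ⟨a⟩, which are four pairs of difference a. It remains to
-- change two of these differences into b. For a ≠ b, let v = a + b and follow pairs of the matching and
-- pairs {x, x + v} alternately, starting from a free point q. The path ends at a free point y of another
-- coset and does not meet its translate by a. Adding v on its points preserves all differences, except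
-- those of {q, q + a} and {y, y + a}, which become b.

open import Defs
open import Data.Bool using (true; false; if_then_else_)
open import Data.Empty using (⊥; ⊥-elim)
open import Data.Fin using (zero; suc)
open import Data.List using (List; []; _∷_; _++_; map; length; concatMap; filter)
open import Data.List.Membership.Propositional using (_∈_; _∉_; find)
open import Data.List.Membership.Propositional.Properties
  using (∈-∃++; ∈-map⁺; ∈-map⁻; ∈-concatMap⁻; ∈-++⁺ˡ; ∈-++⁺ʳ; ∈-++⁻)
open import Data.List.Properties
  using (++-assoc; length-++; length-map; map-∘; map-cong-local; filter-none; ∷-injective)
open import Data.List.Relation.Binary.Permutation.Propositional
  using (_↭_; prep; swap; ↭-refl; ↭-sym; ↭-trans; ↭-reflexive; ↭⇒↭ₛ)
import Data.List.Relation.Binary.Permutation.Propositional as ↭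
open import Data.List.Relation.Binary.Permutation.Propositional.Properties
  using (∈-resp-↭; map⁺; ↭-length; filter-↭; ↭-map-inv; ++⁺ˡ; ++⁺ʳ; shift; ++-comm)
import Data.List.Relation.Binary.Permutation.Setoid.Properties as ↭S
open import Data.List.Relation.Binary.Subset.Propositional using (_⊆_)
open import Data.List.Relation.Unary.All as All using (All; []; _∷_)
open import Data.List.Relation.Unary.All.Properties using (¬All⇒Any¬; all-filter)
open import Data.List.Relation.Unary.AllPairs using ([]; _∷_)
open import Data.List.Relation.Unary.Any using (here; there)
open import Data.List.Relation.Unary.Unique.Propositional using (Unique)
open import Data.List.Relation.Unary.Unique.Propositional.Properties using (Unique[x∷xs]⇒x∉xs)
import Data.List.Relation.Unary.Unique.Propositional.Properties as Unique
open import Data.Nat using (ℕ; zero; suc; _+_; _*_; _∸_; _^_; _≤_; _<_; z≤n; s≤s)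
open import Data.Nat.Divisibility using (_∣_; divides; ∣m+n∣m⇒∣n; _∣0)
import Data.Nat.Properties as ℕ
open import Data.Nat.Solver using (module +-*-Solver)
import Data.Parity as ℙ
open import Data.Parity using (0ℙ; 1ℙ; _⁻¹)
import Data.Parity.Properties as ℙ
open import Data.Product using (∃; ∃₂; _×_; _,_; proj₁; proj₂) renaming (swap to swapₚ)
open import Data.Sum using (_⊎_; inj₁; inj₂)
open import Data.Vec using (Vec; []; _∷_; lookup; count; toList)
open import Data.Vec.Membership.Propositional.Properties using (∈-toList⁻)
import Data.Vec.Properties as Vec
open import Data.Vec.Relation.Unary.Any using (index)
open import Data.Vec.Relation.Unary.Any.Properties using (lookup-index)
open import Function using (_∘_; id)
open import Relation.Binary.PropositionalEquality hiding ([_])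
open import Relation.Nullary using (¬_; yes; no; does; contradiction)
open import Relation.Nullary.Decidable using (dec-true; dec-false)
open import Relation.Unary using (Pred; Decidable)

-- Arithmetic in an elementary abelian 2-group.

module _ {s : ℕ} where

  open import Data.List.Membership.DecPropositional (_≟_ {s}) public using (_∈?_)

  ⊕-assoc : (x y z : 𝔽₂^ s) → (x ⊕ y) ⊕ z ≡ x ⊕ (y ⊕ z)
  ⊕-assoc = Vec.zipWith-assoc ℙ.+-assoc

  ⊕-comm : (x y : 𝔽₂^ s) → x ⊕ y ≡ y ⊕ x
  ⊕-comm = Vec.zipWith-comm ℙ.+-comm

  ⊕-identityˡ : (x : 𝔽₂^ s) → 𝟎 ⊕ x ≡ x
  ⊕-identityˡ = Vec.zipWith-identityˡ ℙ.+-identityˡ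

  ⊕-identityʳ : (x : 𝔽₂^ s) → x ⊕ 𝟎 ≡ x
  ⊕-identityʳ = Vec.zipWith-identityʳ ℙ.+-identityʳ

⊕-self : ∀ {s} (x : 𝔽₂^ s) → x ⊕ x ≡ 𝟎
⊕-self []      = refl
⊕-self (p ∷ x) = cong₂ _∷_ (ℙ.p+p≡0ℙ p) (⊕-self x)

module _ {s : ℕ} where

  ⊕-involutive : (x y : 𝔽₂^ s) → x ⊕ y ⊕ y ≡ x
  ⊕-involutive x y = trans (⊕-assoc x y y) (trans (cong (x ⊕_) (⊕-self y)) (⊕-identityʳ x))

  ⊕-cancelˡ-self : (x y : 𝔽₂^ s) → x ⊕ (x ⊕ y) ≡ y
  ⊕-cancelˡ-self x y = trans (⊕-comm x (x ⊕ y)) (trans (cong (_⊕ x) (⊕-comm x y)) (⊕-involutive y x))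

  ⊕-swapʳ : (x y z : 𝔽₂^ s) → x ⊕ y ⊕ z ≡ x ⊕ z ⊕ y
  ⊕-swapʳ x y z = trans (⊕-assoc x y z) (trans (cong (x ⊕_) (⊕-comm y z)) (sym (⊕-assoc x z y)))

  ⊕-cancelʳ : {x y : 𝔽₂^ s} (z : 𝔽₂^ s) → x ⊕ z ≡ y ⊕ z → x ≡ y
  ⊕-cancelʳ {x} {y} z eq = trans (sym (⊕-involutive x z)) (trans (cong (_⊕ z) eq) (⊕-involutive y z))

  ⊕-cancelˡ : (x : 𝔽₂^ s) {y z : 𝔽₂^ s} → x ⊕ y ≡ x ⊕ z → y ≡ z
  ⊕-cancelˡ x {y} {z} eq = trans (sym (⊕-cancelˡ-self x y)) (trans (cong (x ⊕_) eq) (⊕-cancelˡ-self x z))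

  x⊕y≢x : (x : 𝔽₂^ s) {y : 𝔽₂^ s} → y ≢ 𝟎 → x ⊕ y ≢ x
  x⊕y≢x x y≢𝟎 eq = y≢𝟎 (⊕-cancelˡ x (trans eq (sym (⊕-identityʳ x))))

  ⊕-≡𝟎 : {x y : 𝔽₂^ s} → x ⊕ y ≡ 𝟎 → x ≡ y
  ⊕-≡𝟎 {x} {y} eq = ⊕-cancelʳ y (trans eq (sym (⊕-self y)))

-- Lists up to permutation and the pigeonhole principle.

module _ {A : Set} where

  ∈⇒↭ : ∀ {x : A} {xs} → x ∈ xs → ∃ λ ys → xs ↭ x ∷ ys
  ∈⇒↭ x∈xs with ys , zs , refl ← ∈-∃++ x∈xs = ys ++ zs , shift _ ys zs

  Unique-resp-↭ : ∀ {xs ys : List A} → xs ↭ ys → Unique xs → Unique ys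
  Unique-resp-↭ p = ↭S.Unique-resp-↭ (setoid A) (↭⇒↭ₛ p)

  -- Pigeonhole: each element of `xs` uses up one element of `ys`, which is brought to the front by
  -- a permutation and removed. Fresh points and exhaustion of the space both come from here.
  Unique∧⊆⇒≤ : ∀ {xs ys : List A} → Unique xs → xs ⊆ ys → length xs ≤ length ys
  Unique∧⊆⇒≤ {[]}     _ _ = z≤n
  Unique∧⊆⇒≤ {x ∷ xs} u@(_ ∷ u′) sub with zs , p ← ∈⇒↭ (sub (here refl)) =
    subst (suc (length xs) ≤_) (sym (↭-length p)) (s≤s (Unique∧⊆⇒≤ u′ sub′))
    where
    sub′ : xs ⊆ zs
    sub′ z∈xs with ∈-resp-↭ p (sub (there z∈xs))
    ... | here refl = contradiction z∈xs (Unique[x∷xs]⇒x∉xs u)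
    ... | there z∈zs = z∈zs

  Unique-++-disjoint : ∀ xs {ys} {x : A} → Unique (xs ++ ys) → x ∈ xs → x ∉ ys
  Unique-++-disjoint (_ ∷ xs) u       (here refl) x∈ys = Unique[x∷xs]⇒x∉xs u (∈-++⁺ʳ xs x∈ys)
  Unique-++-disjoint (_ ∷ xs) (_ ∷ u) (there x∈xs) x∈ys = Unique-++-disjoint xs u x∈xs x∈ys

  concatMap-↭ : ∀ {B : Set} (f : A → List B) {xs ys} → xs ↭ ys → concatMap f xs ↭ concatMap f ys
  concatMap-↭ f ↭.refl = ↭-refl
  concatMap-↭ f (prep x p) = ++⁺ˡ (f x) (concatMap-↭ f p)
  concatMap-↭ f (swap {xs} {ys} x y p) =
    ↭-trans (↭-reflexive (sym (++-assoc (f x) (f y) _)))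
      (↭-trans (++⁺ʳ _ (++-comm (f x) (f y)))
        (↭-trans (↭-reflexive (++-assoc (f y) (f x) _)) (++⁺ˡ (f y) (++⁺ˡ (f x) (concatMap-↭ f p)))))
  concatMap-↭ f (↭.trans p q) = ↭-trans (concatMap-↭ f p) (concatMap-↭ f q)

-- Enumeration of the space.

vectors : ∀ s → List (𝔽₂^ s)
vectors zero    = [] ∷ []
vectors (suc s) = map (0ℙ ∷_) (vectors s) ++ map (1ℙ ∷_) (vectors s)

vectors-complete : ∀ {s} (x : 𝔽₂^ s) → x ∈ vectors s
vectors-complete []       = here refl
vectors-complete (0ℙ ∷ x) = ∈-++⁺ˡ (∈-map⁺ _ (vectors-complete x))
vectors-complete (1ℙ ∷ x) = ∈-++⁺ʳ _ (∈-map⁺ _ (vectors-complete x))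

vectors-unique : ∀ s → Unique (vectors s)
vectors-unique zero    = [] ∷ []
vectors-unique (suc s) = Unique.++⁺ (Unique.map⁺ Vec.∷-injectiveʳ (vectors-unique s))
  (Unique.map⁺ Vec.∷-injectiveʳ (vectors-unique s)) disjoint
  where
  disjoint : ∀ {x} → x ∈ map (0ℙ ∷_) (vectors s) × x ∈ map (1ℙ ∷_) (vectors s) → ⊥
  disjoint (p , q) with ∈-map⁻ _ p | ∈-map⁻ _ q
  ... | _ , _ , refl | _ , _ , ()

vectors-length : ∀ s → length (vectors s) ≡ 2 ^ s
vectors-length zero    = refl
vectors-length (suc s) = begin
  length (map (0ℙ ∷_) (vectors s) ++ map (1ℙ ∷_) (vectors s)) ≡⟨ length-++ (map (0ℙ ∷_) (vectors s)) ⟩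
  length (map (0ℙ ∷_) (vectors s)) + length (map (1ℙ ∷_) (vectors s))
    ≡⟨ cong₂ _+_ (length-map _ (vectors s)) (trans (length-map _ (vectors s)) (sym (ℕ.+-identityʳ _))) ⟩
  2 * length (vectors s)                                      ≡⟨ cong (2 *_) (vectors-length s) ⟩
  2 ^ suc s ∎
  where open ≡-Reasoning

∃-fresh : ∀ {s} (xs : List (𝔽₂^ s)) → length xs < 2 ^ s → ∃ λ x → x ∉ xs
∃-fresh {s} xs l with All.all? (_∈? xs) (vectors s)
... | yes all = contradiction (subst (_≤ length xs) (vectors-length s)
                  (Unique∧⊆⇒≤ (vectors-unique s) (All.lookup all))) (ℕ.<⇒≱ l)
... | no ¬all with x , _ , x∉ ← find (¬All⇒Any¬ (_∈? xs) _ ¬all) = x , x∉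

exhaustive : ∀ {s} {xs : List (𝔽₂^ s)} → Unique xs → length xs ≡ 2 ^ s → ∀ x → x ∈ xs
exhaustive {s} {xs} u l x with x ∈? xs
... | yes x∈ = x∈
... | no x∉ = contradiction
  (Unique∧⊆⇒≤ (All.tabulate (λ { y∈ refl → x∉ y∈ }) ∷ u) (λ {y} _ → vectors-complete y))
  (ℕ.<⇒≱ (ℕ.≤-reflexive (cong suc (trans (vectors-length s) (sym l)))))

-- Matchings modulo translation by `a`, and alternating paths.

Edge : ℕ → Set
Edge s = 𝔽₂^ s × 𝔽₂^ s

diff : ∀ {s} → Edge s → 𝔽₂^ s
diff (x , y) = x ⊕ y

module Translate {s : ℕ} (a : 𝔽₂^ s) (a≢𝟎 : a ≢ 𝟎) where

  V : Set
  V = 𝔽₂^ s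

  -- A list E stands for a matching in the quotient by a: its edges, together with their translates by a,
  -- form a matching of the whole space exactly when orb E has no repetitions.
  links : Edge s → List (Edge s)
  links (x , y) = (x , y) ∷ (y , x) ∷ (x ⊕ a , y ⊕ a) ∷ (y ⊕ a , x ⊕ a) ∷ []

  Links : List (Edge s) → List (Edge s)
  Links = concatMap links

  orb : List (Edge s) → List V
  orb E = map proj₁ (Links E)

  orb-↭ : ∀ {E E′} → E ↭ E′ → orb E ↭ orb E′
  orb-↭ p = map⁺ proj₁ (concatMap-↭ links p)

  -- `links e` is the orbit of `e` under reversal and translation by `a`, so any member generates
  -- the same orbit. Hence a path may enter an edge at any of its four points.
  links-sub : ∀ {p e} → p ∈ links e → links e ⊆ links p
  links-sub (here refl) q = q
  links-sub (there (here refl)) (here refl) = there (here refl)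
  links-sub (there (here refl)) (there (here refl)) = here refl
  links-sub (there (here refl)) (there (there (here refl))) = there (there (there (here refl)))
  links-sub (there (here refl)) (there (there (there (here refl)))) = there (there (here refl))
  links-sub {e = x , y} (there (there (here refl))) q
    rewrite ⊕-involutive x a | ⊕-involutive y a with q
  ... | here refl = there (there (here refl))
  ... | there (here refl) = there (there (there (here refl)))
  ... | there (there (here refl)) = here refl
  ... | there (there (there (here refl))) = there (here refl)
  links-sub {e = x , y} (there (there (there (here refl)))) q
    rewrite ⊕-involutive x a | ⊕-involutive y a with q
  ... | here refl = there (there (there (here refl)))
  ... | there (here refl) = there (there (here refl))
  ... | there (there (here refl)) = there (here refl)
  ... | there (there (there (here refl))) = here refl

  Links-translate : ∀ {x y} E → (x , y) ∈ Links E → (x ⊕ a , y ⊕ a) ∈ Links E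
  Links-translate (e ∷ E) p with ∈-++⁻ (links e) p
  ... | inj₁ p∈e = ∈-++⁺ˡ (lem p∈e)
    where
    lem : ∀ {x y} → (x , y) ∈ links e → (x ⊕ a , y ⊕ a) ∈ links e
    lem (here refl) = there (there (here refl))
    lem (there (here refl)) = there (there (there (here refl)))
    lem (there (there (here refl))) = here (cong₂ _,_ (⊕-involutive _ a) (⊕-involutive _ a))
    lem (there (there (there (here refl)))) = there (here (cong₂ _,_ (⊕-involutive _ a) (⊕-involutive _ a)))
  ... | inj₂ p∈E = ∈-++⁺ʳ (links e) (Links-translate E p∈E)

  ∈orb⇒link : ∀ {x E} → x ∈ orb E → ∃ λ y → (x , y) ∈ Links E
  ∈orb⇒link p with (_ , y) , l , refl ← ∈-map⁻ proj₁ p = y , l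

  link⇒∈orb : ∀ {x y E} → (x , y) ∈ Links E → x ∈ orb E
  link⇒∈orb = ∈-map⁺ proj₁

  orb-translate : ∀ {x} E → x ∈ orb E → x ⊕ a ∈ orb E
  orb-translate E p with _ , l ← ∈orb⇒link {E = E} p = link⇒∈orb {E = E} (Links-translate E l)

  orb-translate⁻ : ∀ {x} E → x ⊕ a ∈ orb E → x ∈ orb E
  orb-translate⁻ {x} E p = subst (_∈ orb E) (⊕-involutive x a) (orb-translate E p)

  links-distinct : ∀ {e c w} → Unique (map proj₁ (links e)) → (c , w) ∈ links e → c ≢ w × c ⊕ a ≢ w
  links-distinct {x , y} ((x≢y ∷ _ ∷ x≢ya ∷ _) ∷ (y≢xa ∷ _) ∷ (xa≢ya ∷ _) ∷ _) = λ where
    (here refl)                         → x≢y , ≢-sym y≢xa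
    (there (here refl))                 → ≢-sym x≢y , ≢-sym x≢ya
    (there (there (here refl)))         → xa≢ya , λ eq → x≢ya (trans (sym (⊕-involutive x a)) eq)
    (there (there (there (here refl)))) → ≢-sym xa≢ya , λ eq → y≢xa (trans (sym (⊕-involutive y a)) eq)

  -- S is the vertex set of the alternating path from q to end.
  record Path (v : V) (E : List (Edge s)) (q : V) : Set where
    field
      S          : List V
      end        : V
      shift∈     : ∀ {x} → x ∈ S → x ⊕ v ∈ S
      translate∉ : ∀ {x} → x ∈ S → x ⊕ a ∉ S
      closed     : ∀ {x y} → (x , y) ∈ Links E → x ∈ S → y ∈ S
      start∈     : q ∈ S
      end∈       : end ∈ S
      end-free   : end ∉ orb E
      end≢start  : end ≢ q
      ends       : ∀ {z} → z ∉ orb E → z ∈ S → z ≡ q ⊎ z ≡ end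
      alternate  : (χ : V → 𝔽₂) → (∀ x → χ (x ⊕ v) ≡ χ x ⁻¹) →
                   (∀ {x y} → (x , y) ∈ Links E → χ y ≡ χ x ⁻¹) → χ end ≡ χ q ⁻¹

  Path-resp-↭ : ∀ {v E E′ q} → E ↭ E′ → Path v E q → Path v E′ q
  Path-resp-↭ {E = E} {E′} p P = record
    { S = S; end = end; shift∈ = shift∈; translate∉ = translate∉
    ; closed = closed ∘ ∈-resp-↭ (↭-sym links↭); start∈ = start∈; end∈ = end∈
    ; end-free = end-free ∘ ∈-resp-↭ (↭-sym (orb-↭ p)); end≢start = end≢start
    ; ends = λ z∉ → ends (z∉ ∘ ∈-resp-↭ (orb-↭ p))
    ; alternate = λ χ χv χE → alternate χ χv (χE ∘ ∈-resp-↭ links↭)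
    }
    where
    open Path P
    links↭ : Links E ↭ Links E′
    links↭ = concatMap-↭ links p

  module _ {v : V} (v≢𝟎 : v ≢ 𝟎) (v≢a : v ≢ a) where

    -- The path of a single step, which stops because `q ⊕ v` is already free. Its two points lie in
    -- different cosets of ⟨a⟩ because `v` is neither `𝟎` nor `a`.
    trivial-path : ∀ {E q} → q ∉ orb E → q ⊕ v ∉ orb E → Path v E q
    trivial-path {E} {q} q∉ qv∉ = record
      { S = S; end = q ⊕ v; shift∈ = shift∈; translate∉ = translate∉
      ; closed = λ l x∈ → ⊥-elim (outside x∈ (link⇒∈orb {E = E} l))
      ; start∈ = here refl; end∈ = there (here refl); end-free = qv∉; end≢start = x⊕y≢x q v≢𝟎
      ; ends = λ { _ (here eq) → inj₁ eq ; _ (there (here eq)) → inj₂ eq }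
      ; alternate = λ χ χv _ → χv q
      }
      where
      S : List V
      S = q ∷ q ⊕ v ∷ []

      outside : ∀ {x} → x ∈ S → x ∉ orb E
      outside (here refl) = q∉
      outside (there (here refl)) = qv∉

      shift∈ : ∀ {x} → x ∈ S → x ⊕ v ∈ S
      shift∈ (here refl) = there (here refl)
      shift∈ (there (here refl)) = here (⊕-involutive q v)

      translate∉ : ∀ {x} → x ∈ S → x ⊕ a ∉ S
      translate∉ (here refl) (here eq) = x⊕y≢x q a≢𝟎 eq
      translate∉ (here refl) (there (here eq)) = v≢a (sym (⊕-cancelˡ q eq))
      translate∉ (there (here refl)) (here eq) =
        v≢a (⊕-cancelˡ q (trans (sym (⊕-involutive (q ⊕ v) a)) (cong (_⊕ a) eq)))
      translate∉ (there (here refl)) (there (here eq)) = x⊕y≢x (q ⊕ v) a≢𝟎 eq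

    -- Inductive step: removing the edge `e` through `q ⊕ v` makes the opposite point `w` free, and
    -- the path from `w` in the smaller matching is prolonged backwards by `q ⊕ v` and `q`.
    module Extend {E : List (Edge s)} {e : Edge s} {q w : V}
      (unique : Unique (orb (e ∷ E))) (q∉ : q ∉ orb (e ∷ E)) (l : (q ⊕ v , w) ∈ links e)
      (P : Path v E w) where

      open Path P

      c : V
      c = q ⊕ v

      c≢w : c ≢ w
      c≢w = proj₁ (links-distinct {e} (Unique.take⁺ 4 unique) l)

      ca≢w : c ⊕ a ≢ w
      ca≢w = proj₂ (links-distinct {e} (Unique.take⁺ 4 unique) l)

      sub : links e ⊆ links (c , w)
      sub = links-sub l

      c∈e : c ∈ map proj₁ (links e)
      c∈e = ∈-map⁺ proj₁ l

      ca∈e : c ⊕ a ∈ map proj₁ (links e)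
      ca∈e = orb-translate {c} (e ∷ []) c∈e

      out : ∀ {x} → x ∈ map proj₁ (links e) → x ∉ orb E
      out = Unique-++-disjoint (map proj₁ (links e)) unique

      w∈e : w ∈ map proj₁ (links e)
      w∈e = ∈-map⁺ proj₁ (links-sub′ (there (here refl)))
        where
        links-sub′ : links (c , w) ⊆ links e
        links-sub′ = links-sub (sub (here refl))

      q∉E : q ∉ orb E
      q∉E = q∉ ∘ ∈-++⁺ʳ (map proj₁ (links e))

      q≢w : q ≢ w
      q≢w refl = q∉ (∈-++⁺ˡ w∈e)

      qa∉ : q ⊕ a ∉ orb (e ∷ E)
      qa∉ = q∉ ∘ orb-translate⁻ (e ∷ E)

      -- S has only one end besides w, so it cannot contain two more uncovered points x and x ⊕ v.
      pair∉S : ∀ {x} → x ∉ orb E → x ⊕ v ∉ orb E → x ≢ w → x ⊕ v ≢ w → x ∉ S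
      pair∉S {x} x∉ xv∉ x≢w xv≢w x∈ with ends x∉ x∈ | ends xv∉ (shift∈ x∈)
      ... | inj₁ eq | _ = x≢w eq
      ... | inj₂ _ | inj₁ eq = xv≢w eq
      ... | inj₂ eq | inj₂ eq′ = x⊕y≢x x v≢𝟎 (trans eq′ (sym eq))

      q∉S : q ∉ S
      q∉S = pair∉S q∉E (out c∈e) q≢w c≢w

      c∉S : c ∉ S
      c∉S p = q∉S (subst (_∈ S) (⊕-involutive q v) (shift∈ p))

      qav≡ca : q ⊕ a ⊕ v ≡ c ⊕ a
      qav≡ca = ⊕-swapʳ q a v

      -- The points `q ⊕ a` and `c ⊕ a` are uncovered by `E`, differ by `v` and are distinct from
      -- `w`, so `pair∉S` applies. This is why the prolonged path still misses its own translate.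
      qa∉S : q ⊕ a ∉ S
      qa∉S = pair∉S (qa∉ ∘ ∈-++⁺ʳ (map proj₁ (links e))) (subst (_∉ orb E) (sym qav≡ca) (out ca∈e))
        (λ { refl → qa∉ (∈-++⁺ˡ w∈e) }) (λ eq → ca≢w (trans (sym qav≡ca) eq))

      ca∉S : c ⊕ a ∉ S
      ca∉S p = qa∉S (subst (_∈ S) (trans (cong (_⊕ v) (sym qav≡ca)) (⊕-involutive (q ⊕ a) v)) (shift∈ p))

      wa∉S : w ⊕ a ∉ S
      wa∉S = translate∉ start∈

      S⁺ : List V
      S⁺ = q ∷ c ∷ S

      shift∈⁺ : ∀ {x} → x ∈ S⁺ → x ⊕ v ∈ S⁺
      shift∈⁺ (here refl)         = there (here refl)
      shift∈⁺ (there (here refl)) = here (⊕-involutive q v)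
      shift∈⁺ (there (there p))   = there (there (shift∈ p))

      translate∉⁺ : ∀ {x} → x ∈ S⁺ → x ⊕ a ∉ S⁺
      translate∉⁺ (here refl) (there (there p)) = qa∉S p
      translate∉⁺ (there (here refl)) (there (there p)) = ca∉S p
      translate∉⁺ (there (there p)) (here eq) =
        qa∉S (subst (_∈ S) (trans (sym (⊕-involutive _ a)) (cong (_⊕ a) eq)) p)
      translate∉⁺ (there (there p)) (there (here eq)) =
        ca∉S (subst (_∈ S) (trans (sym (⊕-involutive _ a)) (cong (_⊕ a) eq)) p)
      translate∉⁺ (there (there p)) (there (there p′)) = translate∉ p p′
      translate∉⁺ (here refl) (here eq) = x⊕y≢x q a≢𝟎 eq
      translate∉⁺ (here refl) (there (here eq)) = v≢a (sym (⊕-cancelˡ q eq))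
      translate∉⁺ (there (here refl)) (here eq) =
        v≢a (⊕-cancelˡ q (trans (sym (⊕-involutive c a)) (cong (_⊕ a) eq)))
      translate∉⁺ (there (here refl)) (there (here eq)) = x⊕y≢x c a≢𝟎 eq

      closed-e : ∀ {x y} → (x , y) ∈ links (c , w) → x ∈ S⁺ → y ∈ S⁺
      closed-e (here refl) _ = there (there start∈)
      closed-e (there (here refl)) _ = there (here refl)
      -- The last two links start at `c ⊕ a` and `w ⊕ a`, translates of points of `S⁺`, hence
      -- outside `S⁺`.
      closed-e (there (there (here refl))) p = ⊥-elim (translate∉⁺ (there (here refl)) p)
      closed-e (there (there (there (here refl)))) p = ⊥-elim (translate∉⁺ (there (there start∈)) p)

      closed⁺ : ∀ {x y} → (x , y) ∈ Links (e ∷ E) → x ∈ S⁺ → y ∈ S⁺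
      closed⁺ m x∈ with ∈-++⁻ (links e) m
      ... | inj₁ m′ = closed-e (sub m′) x∈
      closed⁺ m (here refl) | inj₂ m′ = contradiction (link⇒∈orb {E = E} m′) q∉E
      closed⁺ m (there (here refl)) | inj₂ m′ = contradiction (link⇒∈orb {E = E} m′) (out c∈e)
      closed⁺ m (there (there p)) | inj₂ m′ = there (there (closed m′ p))

      in-e : ∀ {x} → x ∈ map proj₁ (links e) → x ≡ c ⊎ x ≡ w ⊎ x ≡ c ⊕ a ⊎ x ≡ w ⊕ a
      in-e p with (x , y) , m , refl ← ∈-map⁻ proj₁ p with sub m
      ... | here refl = inj₁ refl
      ... | there (here refl) = inj₂ (inj₁ refl)
      ... | there (there (here refl)) = inj₂ (inj₂ (inj₁ refl))
      ... | there (there (there (here refl))) = inj₂ (inj₂ (inj₂ refl))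

      end-free⁺ : end ∉ orb (e ∷ E)
      end-free⁺ m with ∈-++⁻ (map proj₁ (links e)) m
      ... | inj₂ m′ = end-free m′
      ... | inj₁ m′ with in-e m′
      ... | inj₁ eq = c∉S (subst (_∈ S) eq end∈)
      ... | inj₂ (inj₁ eq) = end≢start eq
      ... | inj₂ (inj₂ (inj₁ eq)) = ca∉S (subst (_∈ S) eq end∈)
      ... | inj₂ (inj₂ (inj₂ eq)) = wa∉S (subst (_∈ S) eq end∈)

      ends⁺ : ∀ {z} → z ∉ orb (e ∷ E) → z ∈ S⁺ → z ≡ q ⊎ z ≡ end
      ends⁺ z∉ (here eq) = inj₁ eq
      ends⁺ z∉ (there (here refl)) = contradiction (∈-++⁺ˡ c∈e) z∉
      ends⁺ z∉ (there (there p)) with ends (z∉ ∘ ∈-++⁺ʳ (map proj₁ (links e))) p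
      ... | inj₁ refl = contradiction (∈-++⁺ˡ w∈e) z∉
      ... | inj₂ eq = inj₂ eq

      extend : Path v (e ∷ E) q
      extend = record
        { S = S⁺; end = end; shift∈ = shift∈⁺; translate∉ = translate∉⁺; closed = closed⁺
        ; start∈ = here refl; end∈ = there (there end∈); end-free = end-free⁺
        ; end≢start = λ { refl → q∉S end∈ }; ends = ends⁺
        ; alternate = λ χ χv χE → begin
            χ end     ≡⟨ alternate χ χv (χE ∘ ∈-++⁺ʳ (links e)) ⟩
            χ w ⁻¹    ≡⟨ cong _⁻¹ (χE (∈-++⁺ˡ l)) ⟩
            χ c ⁻¹ ⁻¹ ≡⟨ cong (λ t → t ⁻¹ ⁻¹) (χv q) ⟩
            χ q ⁻¹ ⁻¹ ⁻¹ ≡⟨ cong _⁻¹ (ℙ.⁻¹-involutive (χ q)) ⟩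
            χ q ⁻¹ ∎
        }
        where open ≡-Reasoning

    -- Induction on the number of edges. It is carried by `n` because the matching left after
    -- removing an edge is known only up to permutation.
    path : ∀ n {E q} → length E ≡ n → Unique (orb E) → q ∉ orb E → Path v E q
    path n {E} {q} len unique q∉ with q ⊕ v ∈? orb E
    ... | no qv∉ = trivial-path q∉ qv∉
    ... | yes qv∈ with w , l ← ∈orb⇒link {E = E} qv∈
                  with e , e∈ , l′ ← find (∈-concatMap⁻ links {xs = E} l)
                  with E′ , p ← ∈⇒↭ e∈ with n
    ...   | zero = contradiction (trans (sym (↭-length p)) len) λ ()
    ...   | suc n = Path-resp-↭ (↭-sym p) (Extend.extend unique′ q∉′ l′ (path n len′ (Unique.drop⁺ 4 unique′) w∉))
      where
      unique′ : Unique (orb (e ∷ E′))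
      unique′ = Unique-resp-↭ (orb-↭ p) unique
      q∉′ : q ∉ orb (e ∷ E′)
      q∉′ = q∉ ∘ ∈-resp-↭ (↭-sym (orb-↭ p))
      len′ : length E′ ≡ n
      len′ = ℕ.suc-injective (trans (sym (↭-length p)) len)
      w∉ : w ∉ orb E′
      w∉ = Unique-++-disjoint (map proj₁ (links e)) unique′
        (∈-map⁺ proj₁ (links-sub (links-sub l′ (here refl)) (there (here refl))))

-- Shifting the points of a set.

dup : ∀ {s} → List (𝔽₂^ s) → List (𝔽₂^ s)
dup = concatMap λ x → x ∷ x ∷ []

endpoints : ∀ {s} → List (Edge s) → List (𝔽₂^ s)
endpoints = concatMap λ (x , y) → x ∷ y ∷ []

-- Closure of `T` under adding `v` makes `ψ` an involution, so it preserves disjointness of pairs. A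
-- pair that `T` does not separate receives `v` twice or not at all and keeps its difference.
module ShiftOn {s : ℕ} (v : 𝔽₂^ s) (T : List (𝔽₂^ s)) (shift∈ : ∀ {x} → x ∈ T → x ⊕ v ∈ T) where

  ψ : 𝔽₂^ s → 𝔽₂^ s
  ψ x = if does (x ∈? T) then x ⊕ v else x

  ψ-∈ : ∀ {x} → x ∈ T → ψ x ≡ x ⊕ v
  ψ-∈ {x} x∈ rewrite dec-true (x ∈? T) x∈ = refl

  ψ-∉ : ∀ {x} → x ∉ T → ψ x ≡ x
  ψ-∉ {x} x∉ rewrite dec-false (x ∈? T) x∉ = refl

  ψ-involutive : ∀ x → ψ (ψ x) ≡ x
  ψ-involutive x with x ∈? T
  ... | yes x∈ = trans (ψ-∈ (shift∈ x∈)) (⊕-involutive x v)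
  ... | no x∉ = ψ-∉ x∉

  ψ-injective : ∀ {x y} → ψ x ≡ ψ y → x ≡ y
  ψ-injective {x} {y} eq = trans (sym (ψ-involutive x)) (trans (cong ψ eq) (ψ-involutive y))

  ψₑ : Edge s → Edge s
  ψₑ (x , y) = ψ x , ψ y

  Uncut : Edge s → Set
  Uncut (x , y) = (x ∈ T → y ∈ T) × (y ∈ T → x ∈ T)

  diff-uncut : ∀ e → Uncut e → diff (ψₑ e) ≡ diff e
  diff-uncut (x , y) (f , g) with x ∈? T
  ... | no x∉ = cong (x ⊕_) (ψ-∉ (x∉ ∘ g))
  ... | yes x∈ = begin
    x ⊕ v ⊕ ψ y     ≡⟨ cong (x ⊕ v ⊕_) (ψ-∈ (f x∈)) ⟩
    x ⊕ v ⊕ (y ⊕ v) ≡⟨ ⊕-assoc (x ⊕ v) y v ⟨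
    x ⊕ v ⊕ y ⊕ v   ≡⟨ cong (_⊕ v) (⊕-swapʳ x v y) ⟩
    x ⊕ y ⊕ v ⊕ v   ≡⟨ ⊕-involutive (x ⊕ y) v ⟩
    x ⊕ y ∎
    where open ≡-Reasoning

  diffs-uncut : ∀ es → (∀ {e} → e ∈ es → Uncut e) → map diff (map ψₑ es) ≡ map diff es
  diffs-uncut es uncut = trans (sym (map-∘ es))
    (map-cong-local (All.tabulate λ {e} e∈ → diff-uncut e (uncut e∈)))

-- Absorbing the requests outside the hyperplane.

module Construct {s : ℕ} (a : 𝔽₂^ s) (a≢𝟎 : a ≢ 𝟎) where

  open Translate a a≢𝟎

  Invariant : List V → Set
  Invariant L = ∀ {x} → x ∈ L → x ⊕ a ∈ L

  coset : V → List V → List V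
  coset z L = z ∷ z ⊕ a ∷ L

  coset-invariant : ∀ {z L} → Invariant L → Invariant (coset z L)
  coset-invariant inv (here refl)         = there (here refl)
  coset-invariant inv (there (here refl)) = here (⊕-involutive _ a)
  coset-invariant inv (there (there p))   = there (there (inv p))

  coset-unique : ∀ {z L} → Invariant L → Unique L → z ∉ L → Unique (coset z L)
  coset-unique {z} {L} inv u z∉ =
    (≢-sym (x⊕y≢x z a≢𝟎) ∷ All.tabulate (λ { p refl → z∉ p })) ∷
    All.tabulate (λ { p refl → z∉ (subst (_∈ L) (⊕-involutive z a) (inv p)) }) ∷ u

  orb-length : ∀ E → length (orb E) ≡ 4 * length E
  orb-length [] = refl
  orb-length (e ∷ E) = trans (cong (4 +_) (orb-length E)) (sym (ℕ.*-suc 4 (length E)))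

  diff-links : ∀ {x y e} → (x , y) ∈ links e → x ⊕ y ≡ diff e
  diff-links (here refl) = refl
  diff-links (there (here refl)) = ⊕-comm _ _
  diff-links {e = x , y} (there (there (here refl))) = translate-diff x y
    where
    translate-diff : ∀ x y → x ⊕ a ⊕ (y ⊕ a) ≡ x ⊕ y
    translate-diff x y = trans (sym (⊕-assoc (x ⊕ a) y a))
      (trans (cong (_⊕ a) (⊕-swapʳ x a y)) (⊕-involutive (x ⊕ y) a))
  diff-links {e = x , y} (there (there (there (here refl)))) =
    trans (⊕-comm _ _) (diff-links {e = x , y} (there (there (here refl))))

  edge⇒link : ∀ {e E} → e ∈ E → e ∈ Links E × swapₚ e ∈ Links E
  edge⇒link (here refl) = here refl , there (here refl)
  edge⇒link {E = e ∷ E} (there p) with l , l′ ← edge⇒link p = ∈-++⁺ʳ (links e) l , ∈-++⁺ʳ (links e) l′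

  -- The hyperplane enters only as the kernel of a homomorphism `χ`; by `χa` the two sides are well
  -- defined in the quotient by `a`.
  module Hall (χ : V → 𝔽₂) (χ-⊕ : ∀ x y → χ (x ⊕ y) ≡ χ x ℙ.+ χ y) (χa : χ a ≡ 0ℙ) where

    χ𝟎 : χ 𝟎 ≡ 0ℙ
    χ𝟎 = trans (cong χ (sym (⊕-self a))) (trans (χ-⊕ a a) (ℙ.p+p≡0ℙ (χ a)))

    sum-1ℙ : ∀ {p q} → p ℙ.+ q ≡ 1ℙ → q ≡ p ⁻¹
    sum-1ℙ {0ℙ} refl = refl
    sum-1ℙ {1ℙ} {0ℙ} refl = refl

    -- The raw material of a new edge: two distinct free cosets of ⟨a⟩ on the same side of the
    -- hyperplane. Then `p ⊕ q` lies in the kernel of `χ`, so correcting it to an external `d` takes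
    -- a shift that changes sides.
    record FreePair (E : List (Edge s)) : Set where
      field
        p q  : V
        p∉   : p ∉ orb E
        q∉   : q ∉ coset p (orb E)
        same : χ p ≡ χ q

    two-of-three : (p q r : 𝔽₂) → p ≡ q ⊎ q ≡ r ⊎ p ≡ r
    two-of-three 0ℙ 0ℙ _ = inj₁ refl
    two-of-three 1ℙ 1ℙ _ = inj₁ refl
    two-of-three 0ℙ 1ℙ 0ℙ = inj₂ (inj₂ refl)
    two-of-three 0ℙ 1ℙ 1ℙ = inj₂ (inj₁ refl)
    two-of-three 1ℙ 0ℙ 0ℙ = inj₂ (inj₁ refl)
    two-of-three 1ℙ 0ℙ 1ℙ = inj₂ (inj₂ refl)

    bound : ∀ E k → 4 * suc (length E) < 2 ^ s → k ≤ 4 → k + length (orb E) < 2 ^ s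
    bound E k l k≤4 = ℕ.≤-<-trans (ℕ.+-monoˡ-≤ (length (orb E)) k≤4)
      (subst (_< 2 ^ s) (trans (ℕ.*-suc 4 (length E)) (cong (4 +_) (sym (orb-length E)))) l)

    -- The bound leaves room for three free cosets, and `χ` has only two values. The third choice
    -- has to avoid `4 + 4 * length E` points, which is where the bound is tight.
    free-pair : ∀ E → 4 * suc (length E) < 2 ^ s → FreePair E
    free-pair E l with p , p∉ ← ∃-fresh (orb E) (bound E 0 l z≤n)
                  with q , q∉ ← ∃-fresh (coset p (orb E)) (bound E 2 l (s≤s (s≤s z≤n)))
                  with r , r∉ ← ∃-fresh (coset q (coset p (orb E))) (bound E 4 l ℕ.≤-refl)
                  with two-of-three (χ p) (χ q) (χ r)
    ... | inj₁ eq = record { p∉ = p∉; q∉ = q∉; same = eq }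
    ... | inj₂ (inj₁ eq) = record
      { p∉ = q∉ ∘ there ∘ there
      ; q∉ = λ { (here eq) → r∉ (here eq) ; (there (here eq)) → r∉ (there (here eq))
               ; (there (there m)) → r∉ (there (there (there (there m)))) }
      ; same = eq }
    ... | inj₂ (inj₂ eq) = record { p∉ = p∉; q∉ = r∉ ∘ there ∘ there; same = eq }

    -- The pair `p`, `q` has difference `p ⊕ q` instead of `d`. The shift `v` is the discrepancy:
    -- adding it along the path from `q`, with `p` left in place, corrects the new edge and keeps
    -- the differences of the old ones.
    module AddRequest (d : V) (χd : χ d ≡ 1ℙ) {E : List (Edge s)} (unique : Unique (orb E))
      (external : ∀ {e} → e ∈ E → χ (diff e) ≡ 1ℙ) (free : FreePair E) where

      open FreePair free

      v : V
      v = d ⊕ (p ⊕ q)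

      χv : χ v ≡ 1ℙ
      χv = begin
        χ v                     ≡⟨ χ-⊕ d (p ⊕ q) ⟩
        χ d ℙ.+ χ (p ⊕ q)       ≡⟨ cong₂ ℙ._+_ χd (χ-⊕ p q) ⟩
        1ℙ ℙ.+ (χ p ℙ.+ χ q)    ≡⟨ cong (λ t → 1ℙ ℙ.+ (χ p ℙ.+ t)) same ⟨
        1ℙ ℙ.+ (χ p ℙ.+ χ p)    ≡⟨ cong (1ℙ ℙ.+_) (ℙ.p+p≡0ℙ (χ p)) ⟩
        1ℙ ∎
        where open ≡-Reasoning

      χ-≢ : ∀ {x y} → χ x ≡ 1ℙ → χ y ≡ 0ℙ → x ≢ y
      χ-≢ h₁ h₀ refl with () ← trans (sym h₁) h₀

      q∉orb : q ∉ orb E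
      q∉orb = q∉ ∘ there ∘ there

      open Path (path (χ-≢ χv χ𝟎) (χ-≢ χv χa) (length E) {E} refl unique q∉orb)

      χ-link : ∀ {x y} → (x , y) ∈ Links E → χ y ≡ χ x ⁻¹
      χ-link {x} {y} l with e , e∈ , l′ ← find (∈-concatMap⁻ links {xs = E} l) =
        sum-1ℙ (trans (sym (χ-⊕ x y)) (trans (cong χ (diff-links l′)) (external e∈)))

      -- The path starts and ends with a shift by `v`, so its number of steps is odd, and every step
      -- changes the side.
      χ-end : χ end ≢ χ q
      χ-end eq = ℙ.p≢p⁻¹ (χ q) (trans (sym eq)
        (alternate χ (λ x → trans (χ-⊕ x v) (trans (cong (χ x ℙ.+_) χv) (ℙ.+-comm (χ x) 1ℙ))) χ-link))

      free∉S : ∀ {x} → x ∉ orb E → x ≢ q → χ x ≡ χ q → x ∉ S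
      free∉S x∉ x≢q eq x∈ with ends x∉ x∈
      ... | inj₁ x≡q = x≢q x≡q
      ... | inj₂ refl = χ-end eq

      -- The path together with its translate. Being invariant under `a`, this set makes `ψ` commute
      -- with translation by `a`, so that `E⁺` is again a matching in the quotient.
      T : List V
      T = S ++ map (_⊕ a) S

      ∈T⁺ : ∀ {x} → x ⊕ a ∈ S → x ∈ T
      ∈T⁺ {x} m = ∈-++⁺ʳ S (subst (_∈ map (_⊕ a) S) (⊕-involutive x a) (∈-map⁺ (_⊕ a) m))

      ∈T⁻ : ∀ {x} → x ∈ T → x ∈ S ⊎ x ⊕ a ∈ S
      ∈T⁻ m with ∈-++⁻ S m
      ... | inj₁ m′ = inj₁ m′
      ... | inj₂ m′ with y , y∈ , refl ← ∈-map⁻ (_⊕ a) m′ = inj₂ (subst (_∈ S) (sym (⊕-involutive y a)) y∈)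

      T-shift : ∀ {x} → x ∈ T → x ⊕ v ∈ T
      T-shift {x} m with ∈T⁻ m
      ... | inj₁ m′ = ∈-++⁺ˡ (shift∈ m′)
      ... | inj₂ m′ = ∈T⁺ (subst (_∈ S) (⊕-swapʳ x a v) (shift∈ m′))

      T-translate : ∀ {x} → x ∈ T → x ⊕ a ∈ T
      T-translate {x} m with ∈T⁻ m
      ... | inj₁ m′ = ∈T⁺ (subst (_∈ S) (sym (⊕-involutive x a)) m′)
      ... | inj₂ m′ = ∈-++⁺ˡ m′

      T-closed : ∀ {x y} → (x , y) ∈ Links E → x ∈ T → y ∈ T
      T-closed l m with ∈T⁻ m
      ... | inj₁ m′ = ∈-++⁺ˡ (closed l m′)
      ... | inj₂ m′ = ∈T⁺ (closed (Links-translate E l) m′)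

      open ShiftOn v T T-shift

      ψ-translate : ∀ x → ψ (x ⊕ a) ≡ ψ x ⊕ a
      ψ-translate x with x ∈? T
      ... | yes m = trans (ψ-∈ (T-translate m)) (⊕-swapʳ x a v)
      ... | no m = ψ-∉ (m ∘ subst (_∈ T) (⊕-involutive x a) ∘ T-translate)

      orb-ψ : ∀ F → orb (map ψₑ F) ≡ map ψ (orb F)
      orb-ψ [] = refl
      orb-ψ ((x , y) ∷ F) = cong₂ (λ t u → ψ x ∷ ψ y ∷ t ∷ u) (sym (ψ-translate x))
        (cong₂ _∷_ (sym (ψ-translate y)) (orb-ψ F))

      E⁺ : List (Edge s)
      E⁺ = map ψₑ ((p , q) ∷ E)

      p∉T : p ∉ T
      p∉T m with ∈T⁻ m
      ... | inj₁ m′ = free∉S p∉ (λ eq → q∉ (here (sym eq))) same m′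
      -- Since `χ a` vanishes, `p ⊕ a` is on the side of `q` too, and the same argument keeps it off
      -- the path.
      ... | inj₂ m′ = free∉S (p∉ ∘ orb-translate⁻ E) (λ eq → q∉ (there (here (sym eq))))
        (trans (χ-⊕ p a) (trans (cong (χ p ℙ.+_) χa) (trans (ℙ.+-identityʳ (χ p)) same))) m′

      diff-new : ψ p ⊕ ψ q ≡ d
      diff-new = begin
        ψ p ⊕ ψ q             ≡⟨ cong₂ _⊕_ (ψ-∉ p∉T) (ψ-∈ (∈-++⁺ˡ start∈)) ⟩
        p ⊕ (q ⊕ v)           ≡⟨ ⊕-assoc p q v ⟨
        p ⊕ q ⊕ (d ⊕ (p ⊕ q)) ≡⟨ cong (p ⊕ q ⊕_) (⊕-comm d (p ⊕ q)) ⟩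
        p ⊕ q ⊕ (p ⊕ q ⊕ d)   ≡⟨ ⊕-cancelˡ-self (p ⊕ q) d ⟩
        d ∎
        where open ≡-Reasoning

      diffs⁺ : map diff E⁺ ≡ d ∷ map diff E
      diffs⁺ = cong₂ _∷_ diff-new (diffs-uncut E λ e∈ → T-closed (proj₁ (edge⇒link e∈)) , T-closed (proj₂ (edge⇒link e∈)))

      unique⁺ : Unique (orb E⁺)
      unique⁺ = subst Unique (sym (orb-ψ ((p , q) ∷ E))) (Unique.map⁺ ψ-injective
        (Unique-resp-↭ order (coset-unique (coset-invariant (orb-translate E))
          (coset-unique (orb-translate E) unique p∉) q∉)))
        where
        order : coset q (coset p (orb E)) ↭ orb ((p , q) ∷ E)
        order = ↭-trans (prep q (swap _ _ ↭-refl)) (↭-trans (swap _ _ ↭-refl) (prep p (prep q (swap _ _ ↭-refl))))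

    hall : ∀ {D} → All (λ d → χ d ≡ 1ℙ) D → 4 * length D < 2 ^ s →
           ∃ λ E → map diff E ≡ D × Unique (orb E)
    hall [] _ = [] , refl , []
    hall {d ∷ D} (χd ∷ χD) l with hall χD (ℕ.≤-<-trans (ℕ.*-monoʳ-≤ 4 (ℕ.n≤1+n (length D))) l)
    ... | E , eq , unique = E⁺ , trans diffs⁺ (cong (d ∷_) eq) , unique⁺
      where
      len : length E ≡ length D
      len = trans (sym (length-map diff E)) (cong length eq)
      open AddRequest d χd unique (λ e∈ → All.lookup χD (subst (_ ∈_) eq (∈-map⁺ diff e∈)))
             (free-pair E (subst (λ k → 4 * suc k < 2 ^ s) (sym len) l))

  -- Lifting the matching and correcting two differences.

  loop : V → Edge s
  loop z = z , z ⊕ a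

  diff-loop : ∀ z → diff (loop z) ≡ a
  diff-loop z = ⊕-cancelˡ-self z a

  -- The lift from the quotient: an edge and its translate by `a` have the same difference, so each
  -- request is served twice.
  double : List (Edge s) → List (Edge s)
  double = concatMap λ (x , y) → (x , y) ∷ (x ⊕ a , y ⊕ a) ∷ []

  endpoints-double : ∀ E → endpoints (double E) ≡ orb E
  endpoints-double [] = refl
  endpoints-double ((x , y) ∷ E) = cong (λ L → x ∷ y ∷ x ⊕ a ∷ y ⊕ a ∷ L) (endpoints-double E)

  diff-double : ∀ E → map diff (double E) ≡ dup (map diff E)
  diff-double [] = refl
  diff-double (e ∷ E) = cong₂ (λ d L → diff e ∷ d ∷ L)
    (diff-links {e = e} (there (there (here refl)))) (diff-double E)

  double⇒link : ∀ {e} E → e ∈ double E → e ∈ Links E × swapₚ e ∈ Links E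
  double⇒link (e ∷ E) (here refl) = here refl , there (here refl)
  double⇒link (e ∷ E) (there (here refl)) = there (there (here refl)) , there (there (there (here refl)))
  double⇒link (e ∷ E) (there (there m)) with l , l′ ← double⇒link E m = ∈-++⁺ʳ (links e) l , ∈-++⁺ʳ (links e) l′

  -- `size` says that exactly eight points, four cosets of ⟨a⟩, remain outside `orb E`.
  module Complete {E : List (Edge s)} (unique : Unique (orb E)) (size : 4 * length E + 8 ≡ 2 ^ s) where

    abstract
      free : ∀ k → k < 8 → (L : List V) → length L ≡ k + length (orb E) → ∃ λ z → z ∉ L
      free k k<8 L eq = ∃-fresh L (begin-strict
        length L             ≡⟨ eq ⟩
        k + length (orb E)   ≡⟨ cong (k +_) (orb-length E) ⟩
        k + 4 * length E     <⟨ ℕ.+-monoˡ-< (4 * length E) k<8 ⟩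
        8 + 4 * length E     ≡⟨ ℕ.+-comm 8 (4 * length E) ⟩
        4 * length E + 8     ≡⟨ size ⟩
        2 ^ s ∎)
        where open ℕ.≤-Reasoning

    -- The four free cosets become pairs of difference `a` and complete the lifted matching to the
    -- whole space. The cosets of `y` and `q` stand third and fourth, where `b` is wanted in a
    -- `Completion`.
    module Frame {q y p r : V} (q∉ : q ∉ orb E) (y∉ : y ∉ coset q (orb E))
      (p∉ : p ∉ coset y (coset q (orb E))) (r∉ : r ∉ coset p (coset y (coset q (orb E)))) where

      edges : List (Edge s)
      edges = loop r ∷ loop p ∷ loop y ∷ loop q ∷ double E

      edges-unique : Unique (endpoints edges)
      edges-unique = subst (λ L → Unique (coset r (coset p (coset y (coset q L))))) (sym (endpoints-double E))
        (coset-unique (coset-invariant (coset-invariant (coset-invariant inv)))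
          (coset-unique (coset-invariant (coset-invariant inv))
            (coset-unique (coset-invariant inv) (coset-unique inv unique q∉) y∉) p∉) r∉)
        where
        inv : Invariant (orb E)
        inv = orb-translate E

      edges-diff : map diff edges ≡ a ∷ a ∷ a ∷ a ∷ dup (map diff E)
      edges-diff = cong₂ _∷_ (diff-loop r) (cong₂ _∷_ (diff-loop p) (cong₂ _∷_ (diff-loop y)
        (cong₂ _∷_ (diff-loop q) (diff-double E))))

    Completion : V → Set
    Completion b = ∃ λ Es → map diff Es ≡ a ∷ a ∷ b ∷ b ∷ dup (map diff E) × Unique (endpoints Es)

    -- Outside the quotient by a, the path from q separates q from q ⊕ a and end from end ⊕ a, so
    -- shifting it by a ⊕ b turns precisely these two differences a into b.
    module Distinct {b q : V} (q∉ : q ∉ orb E) (P : Path (a ⊕ b) E q) where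

      open Path P

      end∉ : end ∉ coset q (orb E)
      end∉ (here eq) = end≢start eq
      end∉ (there (here eq)) = translate∉ start∈ (subst (_∈ S) eq end∈)
      end∉ (there (there m)) = end-free m

      module _ {p r : V} (p∉ : p ∉ coset end (coset q (orb E)))
        (r∉ : r ∉ coset p (coset end (coset q (orb E)))) where

        open Frame q∉ end∉ p∉ r∉
        open ShiftOn (a ⊕ b) S shift∈

        uncovered∉S : ∀ {z} → z ∉ coset end (coset q (orb E)) → z ∉ S
        uncovered∉S z∉ z∈ with ends (z∉ ∘ there ∘ there ∘ there ∘ there) z∈
        ... | inj₁ eq = z∉ (there (there (here eq)))
        ... | inj₂ eq = z∉ (here eq)

        diff-outer : ∀ {z} → z ∉ coset end (coset q (orb E)) → diff (ψₑ (loop z)) ≡ a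
        diff-outer {z} z∉ = trans (cong₂ _⊕_ (ψ-∉ (uncovered∉S z∉)) (ψ-∉ (uncovered∉S za∉))) (diff-loop z)
          where
          za∉ : z ⊕ a ∉ coset end (coset q (orb E))
          za∉ m = z∉ (subst (_∈ coset end (coset q (orb E))) (⊕-involutive z a)
            (coset-invariant (coset-invariant (orb-translate E)) m))

        diff-cut : ∀ {z} → z ∈ S → diff (ψₑ (loop z)) ≡ b
        diff-cut {z} z∈ = begin
          ψ z ⊕ ψ (z ⊕ a)       ≡⟨ cong₂ _⊕_ (ψ-∈ z∈) (ψ-∉ (translate∉ z∈)) ⟩
          z ⊕ (a ⊕ b) ⊕ (z ⊕ a) ≡⟨ cong (_⊕ (z ⊕ a)) (⊕-assoc z a b) ⟨
          z ⊕ a ⊕ b ⊕ (z ⊕ a)   ≡⟨ ⊕-comm _ (z ⊕ a) ⟩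
          z ⊕ a ⊕ (z ⊕ a ⊕ b)   ≡⟨ ⊕-cancelˡ-self (z ⊕ a) b ⟩
          b ∎
          where open ≡-Reasoning

        uncut : ∀ {e} → e ∈ double E → Uncut e
        uncut e∈ with l , l′ ← double⇒link E e∈ = closed l , closed l′

        diffs : map diff (map ψₑ edges) ≡ a ∷ a ∷ b ∷ b ∷ dup (map diff E)
        diffs = cong₂ _∷_ (diff-outer (r∉ ∘ there ∘ there)) (cong₂ _∷_ (diff-outer p∉)
          (cong₂ _∷_ (diff-cut end∈) (cong₂ _∷_ (diff-cut start∈)
            (trans (diffs-uncut (double E) uncut) (diff-double E)))))

        endpoints-ψ : ∀ F → endpoints (map ψₑ F) ≡ map ψ (endpoints F)
        endpoints-ψ [] = refl
        endpoints-ψ ((x , y) ∷ F) = cong (λ L → ψ x ∷ ψ y ∷ L) (endpoints-ψ F)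

        completion : Completion b
        completion = map ψₑ edges , diffs ,
          subst Unique (sym (endpoints-ψ edges)) (Unique.map⁺ ψ-injective edges-unique)

      complete-≢ : Completion b
      -- Two of the four free cosets are taken, so four of the eight points; `ℕ.m≤m+n 5 3` is the
      -- proof of `4 < 8`.
      complete-≢ with p , p∉ ← free 4 (ℕ.m≤m+n 5 3) (coset end (coset q (orb E))) refl
                 with r , r∉ ← free 6 (ℕ.m≤m+n 7 1) (coset p (coset end (coset q (orb E)))) refl
                 = completion p∉ r∉

    complete-≡ : ∀ {q} → q ∉ orb E → Completion a
    complete-≡ {q} q∉ with y , y∉ ← free 2 (ℕ.m≤m+n 3 5) (coset q (orb E)) refl
                      with p , p∉ ← free 4 (ℕ.m≤m+n 5 3) (coset y (coset q (orb E))) refl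
                      with r , r∉ ← free 6 (ℕ.m≤m+n 7 1) (coset p (coset y (coset q (orb E)))) refl
                      = let open Frame q∉ y∉ p∉ r∉ in edges , edges-diff , edges-unique

    complete : ∀ b → b ≢ 𝟎 → Completion b
    complete b b≢𝟎 with q , q∉ ← free 0 (s≤s z≤n) (orb E) refl with a ≟ b
    ... | yes refl = complete-≡ q∉
    -- A path needs a shift other than `𝟎` and `a`; for `a ⊕ b` these conditions are `a ≢ b` and
    -- `b ≢ 𝟎`.
    ... | no a≢b = Distinct.complete-≢ q∉
      (path (a≢b ∘ ⊕-≡𝟎) (x⊕y≢x a b≢𝟎) (length E) {E} refl unique q∉)

-- A hyperplane as the kernel of a homomorphism.

linComb-⊕ : ∀ {s d} (c c′ : 𝔽₂^ d) (b : Vec (𝔽₂^ s) d) → linComb (c ⊕ c′) b ≡ linComb c b ⊕ linComb c′ b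
linComb-⊕ [] [] [] = sym (⊕-identityˡ 𝟎)
linComb-⊕ (p ∷ c) (p′ ∷ c′) (x ∷ b) = begin
  (p ℙ.+ p′) ⊙ x ⊕ linComb (c ⊕ c′) b           ≡⟨ cong₂ _⊕_ (⊙-+ p p′ x) (linComb-⊕ c c′ b) ⟩
  p ⊙ x ⊕ p′ ⊙ x ⊕ (linComb c b ⊕ linComb c′ b) ≡⟨ ⊕-assoc _ (linComb c b) _ ⟨
  p ⊙ x ⊕ p′ ⊙ x ⊕ linComb c b ⊕ linComb c′ b   ≡⟨ cong (_⊕ linComb c′ b) (⊕-swapʳ (p ⊙ x) (p′ ⊙ x) _) ⟩
  p ⊙ x ⊕ linComb c b ⊕ p′ ⊙ x ⊕ linComb c′ b   ≡⟨ ⊕-assoc (p ⊙ x ⊕ linComb c b) _ _ ⟩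
  linComb (p ∷ c) (x ∷ b) ⊕ linComb (p′ ∷ c′) (x ∷ b) ∎
  where
  open ≡-Reasoning
  ⊙-+ : ∀ {s} p q (x : 𝔽₂^ s) → (p ℙ.+ q) ⊙ x ≡ p ⊙ x ⊕ q ⊙ x
  ⊙-+ p q []      = refl
  ⊙-+ p q (r ∷ x) = cong₂ _∷_ (ℙ.*-distribʳ-+ r p q) (⊙-+ p q x)

injective⇒surjective : ∀ {s} (f : 𝔽₂^ s → 𝔽₂^ s) → (∀ {x y} → f x ≡ f y → x ≡ y) → ∀ y → ∃ λ x → y ≡ f x
injective⇒surjective {s} f inj y
  with x , _ , eq ← ∈-map⁻ f (exhaustive (Unique.map⁺ inj (vectors-unique s))
                      (trans (length-map f (vectors s)) (vectors-length s)) y) = x , eq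

module Hyperplane {ℓ} {s : ℕ} {H : Pred (𝔽₂^ (suc s)) ℓ} (H? : Decidable H) (hyp : IsHyperplane H) where

  open IsSubspace (proj₁ hyp)
  open IsBasisOf (proj₂ (proj₂ hyp))

  private
    basis = proj₁ (proj₂ hyp)

  linComb-mem : ∀ {d} (c : 𝔽₂^ d) (b : Vec (𝔽₂^ (suc s)) d) → (∀ i → H (lookup b i)) → H (linComb c b)
  linComb-mem [] [] _ = 0-mem
  linComb-mem (p ∷ c) (x ∷ b) h = ⊕-closed (⊙-closed p (h zero)) (linComb-mem c b (h ∘ suc))

  span-mem : ∀ c → H (linComb c basis)
  span-mem c = linComb-mem c basis members

  ∉-⊕-∈ : ∀ {x y} → ¬ H x → H y → ¬ H (x ⊕ y)
  ∉-⊕-∈ {x} {y} x∉ y∈ xy = x∉ (subst H (⊕-involutive x y) (⊕-closed xy y∈))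

  -- The translate of H by a point x outside H has as many points as H, so it is the complement of H.
  ∉-⊕-∉ : ∀ {x y} → ¬ H x → ¬ H y → H (x ⊕ y)
  ∉-⊕-∉ {x} {y} x∉ y∉ = decompose (injective⇒surjective f f-injective y)
    where
    f : 𝔽₂^ (suc s) → 𝔽₂^ (suc s)
    f (0ℙ ∷ c) = linComb c basis
    f (1ℙ ∷ c) = x ⊕ linComb c basis

    span-injective : ∀ {c c′} → linComb c basis ≡ linComb c′ basis → c ≡ c′
    span-injective {c} {c′} eq = ⊕-≡𝟎 (independent (c ⊕ c′)
      (trans (linComb-⊕ c c′ basis) (trans (cong (_⊕ linComb c′ basis) eq) (⊕-self _))))

    f-injective : ∀ {c c′} → f c ≡ f c′ → c ≡ c′
    f-injective {0ℙ ∷ c} {0ℙ ∷ c′} eq = cong (0ℙ ∷_) (span-injective eq)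
    f-injective {0ℙ ∷ c} {1ℙ ∷ c′} eq = ⊥-elim (∉-⊕-∈ x∉ (span-mem c′) (subst H eq (span-mem c)))
    f-injective {1ℙ ∷ c} {0ℙ ∷ c′} eq = ⊥-elim (∉-⊕-∈ x∉ (span-mem c) (subst H (sym eq) (span-mem c′)))
    f-injective {1ℙ ∷ c} {1ℙ ∷ c′} eq = cong (1ℙ ∷_) (span-injective (⊕-cancelˡ x eq))

    decompose : (∃ λ c → y ≡ f c) → H (x ⊕ y)
    decompose (0ℙ ∷ c , refl) = contradiction (span-mem c) y∉
    decompose (1ℙ ∷ c , refl) = subst H (sym (⊕-cancelˡ-self x _)) (span-mem c)

  -- The linear functional with kernel `H`, read off from the decider instead of coordinates.
  -- Additivity is the statement that `H` has index two.
  χ : 𝔽₂^ (suc s) → 𝔽₂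
  χ x = if does (H? x) then 0ℙ else 1ℙ

  χ-∈ : ∀ {x} → H x → χ x ≡ 0ℙ
  χ-∈ {x} x∈ rewrite dec-true (H? x) x∈ = refl

  χ-∉ : ∀ {x} → ¬ H x → χ x ≡ 1ℙ
  χ-∉ {x} x∉ rewrite dec-false (H? x) x∉ = refl

  χ-⊕ : ∀ x y → χ (x ⊕ y) ≡ χ x ℙ.+ χ y
  χ-⊕ x y with H? x | H? y
  ... | yes x∈ | yes y∈ = χ-∈ (⊕-closed x∈ y∈)
  ... | yes x∈ | no y∉  = χ-∉ (subst (¬_ ∘ H) (⊕-comm y x) (∉-⊕-∈ y∉ x∈))
  ... | no x∉  | yes y∈ = χ-∉ (∉-⊕-∈ x∉ y∈)
  ... | no x∉  | no y∉  = χ-∈ (∉-⊕-∉ x∉ y∉)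

-- Halving the list of requests.

count-toList : ∀ {A : Set} {ℓ n} {P : Pred A ℓ} (P? : Decidable P) (xs : Vec A n) →
               count P? xs ≡ length (filter P? (toList xs))
count-toList P? [] = refl
count-toList P? (x ∷ xs) with P? x
... | yes _ = cong suc (count-toList P? xs)
... | no _  = count-toList P? xs

filter-split : ∀ {A : Set} {ℓ} {P : Pred A ℓ} (P? : Decidable P) (xs : List A) →
               ∃ λ ys → xs ↭ filter P? xs ++ ys × All (¬_ ∘ P) ys
filter-split P? [] = [] , ↭-refl , []
filter-split P? (x ∷ xs) with ys , p , out ← filter-split P? xs with P? x
... | yes _ = ys , prep x p , out
... | no x∉ = x ∷ ys , ↭-trans (prep x p) (↭-sym (shift x (filter P? xs) ys)) , x∉ ∷ out

-- Applied to `H?`, this turns the four holes of the request list into two holes of its half.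
filter-dup : ∀ {s ℓ} {P : Pred (𝔽₂^ s) ℓ} (P? : Decidable P) xs →
             length (filter P? (dup xs)) ≡ 2 * length (filter P? xs)
filter-dup P? [] = refl
filter-dup P? (x ∷ xs) with does (P? x) in eq
... | true  rewrite eq = trans (cong (2 +_) (filter-dup P? xs)) (sym (ℕ.*-suc 2 _))
... | false rewrite eq = filter-dup P? xs

2∣filter-drop : ∀ {s ℓ} {P : Pred (𝔽₂^ s) ℓ} (P? : Decidable P) x xs →
                2 ∣ length (filter P? (x ∷ x ∷ xs)) → 2 ∣ length (filter P? xs)
2∣filter-drop P? x xs with does (P? x) in eq
... | true  rewrite eq = λ h → ∣m+n∣m⇒∣n h (divides 1 refl)
... | false rewrite eq = id

length-dup : ∀ {s} (xs : List (𝔽₂^ s)) → length (dup xs) ≡ 2 * length xs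
length-dup [] = refl
length-dup (x ∷ xs) = trans (cong (2 +_) (length-dup xs)) (sym (ℕ.*-suc 2 (length xs)))

-- By evenness the head occurs again, and removing both copies keeps every multiplicity even. The
-- bound `n` drives the recursion, since the rest is known only up to permutation.
halve : ∀ {s} n (L : List (𝔽₂^ s)) → length L ≤ n → (∀ v → 2 ∣ length (filter (v ≟_) L)) →
        ∃ λ K → L ↭ dup K
halve n [] _ _ = [] , ↭-refl
halve (suc n) (x ∷ L) (s≤s l) even with x ∈? L
... | no x∉ = contradiction (subst (2 ∣_) once (even x)) (λ { (divides (suc _) ()) })
  where
  once : length (filter (x ≟_) (x ∷ L)) ≡ 1
  once rewrite dec-true (x ≟ x) refl
    = cong (suc ∘ length) (filter-none (x ≟_) (All.tabulate (λ { p refl → x∉ p })))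
... | yes x∈ with L′ , p ← ∈⇒↭ x∈ = step (halve n L′ (ℕ.<⇒≤ (subst (_≤ n) (↭-length p) l)) even′)
  where
  step : (∃ λ K → L′ ↭ dup K) → ∃ λ K → x ∷ L ↭ dup K
  step (K , q) = x ∷ K , prep x (↭-trans p (prep x q))

  even′ : ∀ v → 2 ∣ length (filter (v ≟_) L′)
  even′ v = 2∣filter-drop (v ≟_) x L′ (subst (2 ∣_) (↭-length (filter-↭ (v ≟_) (prep x p))) (even v))

-- An absent vector has multiplicity zero, so evenness extends to all vectors; in this form it
-- survives the removal of a pair.
2∣multiplicity : ∀ {s n} {M : Vec (𝔽₂^ s) n} → EvenMultiplicities M →
                 ∀ v → 2 ∣ length (filter (v ≟_) (toList M))
2∣multiplicity {M = M} even v with v ∈? toList M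
... | yes v∈ = subst (2 ∣_) (count-toList (v ≟_) M) (even v (∈-toList⁻ v∈))
... | no v∉ = subst (λ L → 2 ∣ length L) (sym (filter-none (v ≟_) (All.tabulate (λ { p refl → v∉ p })))) (2 ∣0)

-- From lists of disjoint edges to pair solutions.

toVec : ∀ {s n} {es : List (Edge s)} {M : Vec (𝔽₂^ s) n} → map diff es ≡ toList M →
        ∃ λ (F : Vec (Edge s) n) → toList F ≡ es × (∀ i → diff (lookup F i) ≡ lookup M i)
toVec {es = []} {[]} _ = [] , refl , λ ()
toVec {es = e ∷ es} {v ∷ M} eq with refl , eq′ ← ∷-injective eq with F , refl , h ← toVec {M = M} eq′ =
  e ∷ F , refl , λ { zero → refl ; (suc i) → h i }

module _ {s : ℕ} where

  _∈ₑ_ : 𝔽₂^ s → Edge s → Set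
  z ∈ₑ (x , y) = z ≡ x ⊎ z ≡ y

  endpoint⇒index : ∀ {n z} (F : Vec (Edge s) n) → z ∈ endpoints (toList F) → ∃ λ i → z ∈ₑ lookup F i
  endpoint⇒index (e ∷ F) (here eq)         = zero , inj₁ eq
  endpoint⇒index (e ∷ F) (there (here eq)) = zero , inj₂ eq
  endpoint⇒index (e ∷ F) (there (there p)) with i , h ← endpoint⇒index F p = suc i , h

  index⇒endpoint : ∀ {n z} (F : Vec (Edge s) n) i → z ∈ₑ lookup F i → z ∈ endpoints (toList F)
  index⇒endpoint (e ∷ F) zero    (inj₁ eq) = here eq
  index⇒endpoint (e ∷ F) zero    (inj₂ eq) = there (here eq)
  index⇒endpoint (e ∷ F) (suc i) h         = there (there (index⇒endpoint F i h))

  head∉tail : ∀ {z e es} → Unique (endpoints (e ∷ es)) → z ∈ₑ e → z ∉ endpoints es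
  head∉tail u       (inj₁ refl) = Unique[x∷xs]⇒x∉xs u ∘ there
  head∉tail (_ ∷ u) (inj₂ refl) = Unique[x∷xs]⇒x∉xs u

  index-unique : ∀ {n z} (F : Vec (Edge s) n) → Unique (endpoints (toList F)) →
                 ∀ {i j} → z ∈ₑ lookup F i → z ∈ₑ lookup F j → i ≡ j
  index-unique (e ∷ F) u {zero}  {zero}  _ _ = refl
  index-unique (e ∷ F) u {zero}  {suc j} h k = contradiction (index⇒endpoint F j k) (head∉tail {es = toList F} u h)
  index-unique (e ∷ F) u {suc i} {zero}  h k = contradiction (index⇒endpoint F i h) (head∉tail {es = toList F} u k)
  index-unique (e ∷ F) (_ ∷ _ ∷ u) {suc i} {suc j} h k = cong suc (index-unique F u h k)

  endpoints-length : (es : List (Edge s)) → length (endpoints es) ≡ 2 * length es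
  endpoints-length [] = refl
  endpoints-length (e ∷ es) = trans (cong (2 +_) (endpoints-length es)) (sym (ℕ.*-suc 2 (length es)))

-- The `2 ^ s` edges have `2 ^ suc s` distinct endpoints, so by counting they exhaust the space.
solution : ∀ {s} {M : Vec (𝔽₂^ (suc s)) (2 ^ s)} {es} → (∀ i → lookup M i ≢ 𝟎) →
           map diff es ↭ toList M → Unique (endpoints es) → HadamardPairSolution M
solution {s} {M} {es} M≢𝟎 p u
  -- The edges are reordered until their differences follow the order of `M`.
  with es′ , eq , q ← ↭-map-inv diff p
  with F , refl , sums ← toVec {M = M} (sym eq) = record
  { x = proj₁ ∘ lookup F
  ; y = proj₂ ∘ lookup F
  ; distinct = λ i x≡y → M≢𝟎 i (trans (sym (sums i)) (trans (cong (_⊕ proj₂ (lookup F i)) x≡y) (⊕-self _)))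
  ; partition = λ z → let i , h = endpoint⇒index F (exhaustive u′ full z) in i , h , index-unique F u′ h
  ; pair-sum = sums
  }
  where
  u′ : Unique (endpoints (toList F))
  u′ = Unique-resp-↭ (concatMap-↭ _ q) u
  full : length (endpoints (toList F)) ≡ 2 ^ suc s
  full = trans (endpoints-length (toList F)) (cong (2 *_) (Vec.length-toList F))

request≢𝟎 : ∀ {s n v} {M : Vec (𝔽₂^ s) n} → (∀ i → lookup M i ≢ 𝟎) → v ∈ toList M → v ≢ 𝟎
request≢𝟎 M≢𝟎 v∈ refl = M≢𝟎 (index v∈′) (sym (lookup-index v∈′))
  where v∈′ = ∈-toList⁻ v∈

two-elements : ∀ {A : Set} (xs : List A) → length xs ≡ 2 → ∃₂ λ a b → xs ≡ a ∷ b ∷ []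
two-elements (a ∷ b ∷ []) _ = a , b , refl

-- Assembly of the pair solution.

theorem26 : ∀ {ℓ} (s : ℕ) → 2 ≤ s →
    (H : Pred (𝔽₂^ s) ℓ) (H? : Decidable H) → IsHyperplane H →
    (M : Vec (𝔽₂^ s) (2 ^ (s ∸ 1))) →
    (∀ i → lookup M i ≢ 𝟎) →
    ⨁ M ≡ 𝟎 →
    holes H? M ≡ 4 →
    EvenMultiplicities M →
    HadamardPairSolution M
theorem26 (suc s) _ H H? hyp M M≢𝟎 _ holes≡4 even
  with K , M↭ ← halve _ (toList M) ℕ.≤-refl (2∣multiplicity even)
  with D , K↭ , external ← filter-split H? K
  -- Cancelling the factor 2 in `holes≡4` leaves exactly two holes in `K`.
  with filter H? K | all-filter H? K | two-elements (filter H? K) (ℕ.*-cancelˡ-≡ _ 2 2 (trans (sym (filter-dup H? K))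
         (trans (sym (↭-length (filter-↭ H? M↭))) (trans (sym (count-toList H? M)) holes≡4))))
... | _ | a∈ ∷ b∈ ∷ [] | a , b , refl =
  assemble (hall (All.map χ-∉ external) (ℕ.<-≤-trans (ℕ.m<m+n _ (s≤s z≤n)) (ℕ.≤-reflexive size)))
  where
  open Hyperplane H? hyp
  open +-*-Solver using (solve; con; _:*_; _:+_; _:=_)

  requests : toList M ↭ dup (a ∷ b ∷ D)
  requests = ↭-trans M↭ (concatMap-↭ _ K↭)

  a≢𝟎 : a ≢ 𝟎
  a≢𝟎 = request≢𝟎 M≢𝟎 (∈-resp-↭ (↭-sym requests) (here refl))

  b≢𝟎 : b ≢ 𝟎
  b≢𝟎 = request≢𝟎 M≢𝟎 (∈-resp-↭ (↭-sym requests) (there (there (here refl))))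

  -- The space has twice as many points as there are requests, and the requests are two copies of
  -- `a ∷ b ∷ D`.
  size : 4 * length D + 8 ≡ 2 ^ suc s
  size = begin
    4 * length D + 8               ≡⟨ solve 1 (λ n → con 4 :* n :+ con 8 := con 2 :* (con 2 :* (con 2 :+ n)))
                                        refl (length D) ⟩
    2 * (2 * length (a ∷ b ∷ D))   ≡⟨ cong (2 *_) (length-dup (a ∷ b ∷ D)) ⟨
    2 * length (dup (a ∷ b ∷ D))   ≡⟨ cong (2 *_) (↭-length requests) ⟨
    2 * length (toList M)          ≡⟨ cong (2 *_) (Vec.length-toList M) ⟩
    2 ^ suc s ∎
    where open ≡-Reasoning

  open Construct a a≢𝟎
  open Hall χ χ-⊕ (χ-∈ a∈)

  assemble : (∃ λ E → map diff E ≡ D × Unique (Translate.orb a a≢𝟎 E)) → HadamardPairSolution M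
  assemble (E , refl , unique)
    with Es , diffs , unique′ ← Complete.complete {E} unique
           (trans (cong (λ k → 4 * k + 8) (sym (length-map diff E))) size) b b≢𝟎
    = solution M≢𝟎 (↭-trans (↭-reflexive diffs) (↭-sym requests)) unique′
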